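{- The variety $\mathsf{C3DP}$ of c3dp-algebras is generated by the class of contract algebras $\{\mathbf{C(B)} : \mathbf{B} \text{ a Boolean algebra}\}$.
   Context: A dp-algebra (double p-algebra) is an algebra $(A;\wedge,\vee,\neg,D,0,1)$ of type $(2,2,1,1,0,0)$ such that $(A;\wedge,\vee,0,1)$ is a bounded distributive lattice; for every $a\in A$, $\neg a$ is the greatest $b\in A$ with $a\wedge b=0$; and for every $a\in A$, $Da$ is the smallest $b\in A$ with $a\vee b=1$. It is regular if $a\wedge Da\le b\vee\neg b$ for all $a,b\in A$. A three-valued dp-algebra is a regular dp-algebra satisfying $\neg x\vee\neg\neg x=1$ and $Dx\wedge DDx=0$. A c3dp-algebra (centred three-valued dp-algebra) is an algebra $(A;\wedge,\vee,\neg,D,0,c,1)$ such that $(A;\wedge,\vee,\neg,D,0,1)$ is a three-valued dp-algebra and the constant $c$ satisfies $\neg c=0$ and $Dc=1$. The class of c3dp-algebras is a variety, denoted $\mathsf{C3DP}$. For a Boolean algebra $\mathbf{B} = (B;\cap,\cup,',0,1)$, the contract algebra on $\mathbf{B}$ is $\mathbf{C(B)} = (C(B);\wedge,\vee,\neg,D,\bot,\gamma,\top)$ with universe $C(B) = \{(a,b) \in B\times B : a \cup b = 1\}$ and operations $(a,b)\wedge(c,d) = (a\cup c, b\cap d)$, $(a,b)\vee(c,d) = (a\cap c, b\cup d)$, $\neg(a,b) = (b,b')$, $D(a,b) = (a',a)$, $\bot = (1,0)$, $\gamma = (1,1)$, $\top=(0,1)$ (with $\bot,\gamma,\top$ interpreting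 $0,c,1$). A variety is generated by a class $K$ of algebras of its signature if it is the smallest variety containing $K$. -}

module Defs where

open import Algebra.Core using (Op₁; Op₂)
open import Algebra.Definitions using (Congruent₁; Congruent₂; Identity)
open import Algebra.Lattice.Bundles using (BooleanAlgebra)
open import Algebra.Lattice.Structures using (IsDistributiveLattice)
import Algebra.Lattice.Properties.BooleanAlgebra as BooleanAlgebraProperties
open import Data.Product using (Σ; _×_; _,_; proj₁; proj₂)
open import Function.Definitions using (Congruent; Surjective)
open import Level using (Level; _⊔_; suc)
open import Relation.Binary.Core using (Rel)
open import Relation.Binary.Definitions using (_Respects_)
open import Relation.Binary.Structures using (IsEquivalence)
import Relation.Binary.Construct.NaturalOrder.Left as NaturalOrder
import Relation.Binary.Reasoning.Setoid as SetoidReasoning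
open import Relation.Unary using (Pred; _⊆_)

private
  variable
    a ℓ p : Level

-- Algebras of type (2,2,1,1,0,0,0), with no identities imposed.
--
-- Carriers are setoids, and _≈_ plays the role of equality. The carrier
-- and _≈_ live in the same universe, so that a class of algebras can be
-- closed under subalgebras and under products indexed by any I : Set ℓ.

record Algebra ℓ : Set (suc ℓ) where
  infix  8 ¬_
  infixr 7 _∧_
  infixr 6 _∨_
  infix  4 _≈_
  field
    Carrier       : Set ℓ
    _≈_           : Rel Carrier ℓ
    _∧_ _∨_       : Op₂ Carrier
    ¬_ D          : Op₁ Carrier
    0# c 1#       : Carrier
    isEquivalence : IsEquivalence _≈_
    ∧-cong        : Congruent₂ _≈_ _∧_
    ∨-cong        : Congruent₂ _≈_ _∨_
    ¬-cong        : Congruent₁ _≈_ ¬_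
    D-cong        : Congruent₁ _≈_ D

  open IsEquivalence isEquivalence public

Class : ∀ ℓ p → Set (suc ℓ ⊔ suc p)
Class ℓ p = Pred (Algebra ℓ) p

record IsHomomorphism (𝐀 𝐁 : Algebra ℓ)
                      (f : Algebra.Carrier 𝐀 → Algebra.Carrier 𝐁) : Set ℓ where
  private
    module A = Algebra 𝐀
    module B = Algebra 𝐁
  field
    cong   : Congruent A._≈_ B._≈_ f
    ∧-homo : ∀ x y → f (x A.∧ y) B.≈ f x B.∧ f y
    ∨-homo : ∀ x y → f (x A.∨ y) B.≈ f x B.∨ f y
    ¬-homo : ∀ x → f (A.¬ x) B.≈ B.¬ (f x)
    D-homo : ∀ x → f (A.D x) B.≈ B.D (f x)
    0-homo : f A.0# B.≈ B.0#
    c-homo : f A.c B.≈ B.c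
    1-homo : f A.1# B.≈ B.1#

record IsSubuniverse (𝐀 : Algebra ℓ) (S : Pred (Algebra.Carrier 𝐀) ℓ) : Set ℓ where
  open Algebra 𝐀
  field
    resp     : S Respects _≈_
    ∧-closed : ∀ {x y} → S x → S y → S (x ∧ y)
    ∨-closed : ∀ {x y} → S x → S y → S (x ∨ y)
    ¬-closed : ∀ {x} → S x → S (¬ x)
    D-closed : ∀ {x} → S x → S (D x)
    0-closed : S 0#
    c-closed : S c
    1-closed : S 1#

subalgebra : (𝐀 : Algebra ℓ) (S : Pred (Algebra.Carrier 𝐀) ℓ) →
             IsSubuniverse 𝐀 S → Algebra ℓ
subalgebra 𝐀 S isSub = record
  { Carrier       = Σ Carrier S
  ; _≈_           = λ (x , _) (y , _) → x ≈ y
  ; _∧_           = λ (x , p) (y , q) → x ∧ y , ∧-closed p q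
  ; _∨_           = λ (x , p) (y , q) → x ∨ y , ∨-closed p q
  ; ¬_            = λ (x , p) → ¬ x , ¬-closed p
  ; D             = λ (x , p) → D x , D-closed p
  ; 0#            = 0# , 0-closed
  ; c             = c , c-closed
  ; 1#            = 1# , 1-closed
  ; isEquivalence = record { refl = refl ; sym = sym ; trans = trans }
  ; ∧-cong        = ∧-cong
  ; ∨-cong        = ∨-cong
  ; ¬-cong        = ¬-cong
  ; D-cong        = D-cong
  }
  where
  open Algebra 𝐀
  open IsSubuniverse isSub

product : (I : Set ℓ) → (I → Algebra ℓ) → Algebra ℓ
product I 𝐀 = record
  { Carrier       = ∀ i → A.Carrier i
  ; _≈_           = λ x y → ∀ i → A._≈_ i (x i) (y i)
  ; _∧_           = λ x y i → A._∧_ i (x i) (y i)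
  ; _∨_           = λ x y i → A._∨_ i (x i) (y i)
  ; ¬_            = λ x i → A.¬_ i (x i)
  ; D             = λ x i → A.D i (x i)
  ; 0#            = λ i → A.0# i
  ; c             = λ i → A.c i
  ; 1#            = λ i → A.1# i
  ; isEquivalence = record
    { refl  = λ i → A.refl i
    ; sym   = λ e i → A.sym i (e i)
    ; trans = λ e e′ i → A.trans i (e i) (e′ i)
    }
  ; ∧-cong        = λ e e′ i → A.∧-cong i (e i) (e′ i)
  ; ∨-cong        = λ e e′ i → A.∨-cong i (e i) (e′ i)
  ; ¬-cong        = λ e i → A.¬-cong i (e i)
  ; D-cong        = λ e i → A.D-cong i (e i)
  }
  where module A i = Algebra (𝐀 i)

record IsVariety (V : Class ℓ p) : Set (suc ℓ ⊔ p) where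
  field
    H-closed : ∀ {𝐀 𝐁} (f : Algebra.Carrier 𝐀 → Algebra.Carrier 𝐁) →
               IsHomomorphism 𝐀 𝐁 f →
               Surjective (Algebra._≈_ 𝐀) (Algebra._≈_ 𝐁) f →
               V 𝐀 → V 𝐁
    S-closed : ∀ {𝐀} S (isSub : IsSubuniverse 𝐀 S) →
               V 𝐀 → V (subalgebra 𝐀 S isSub)
    P-closed : ∀ (I : Set ℓ) (𝐀 : I → Algebra ℓ) →
               (∀ i → V (𝐀 i)) → V (product I 𝐀)

-- A class is a predicate, so its level is independent of ℓ: the competing
-- varieties W range over classes at level r.

record IsVarietyGeneratedBy {ℓ p q} (r : Level) (V : Class ℓ p) (K : Class ℓ q)
                            : Set (suc (ℓ ⊔ r) ⊔ p ⊔ q) where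
  field
    isVariety : IsVariety V
    contains  : K ⊆ V
    smallest  : (W : Class ℓ r) → IsVariety W → K ⊆ W → V ⊆ W

module _ {A : Set a} where

  IsGreatest : Rel A ℓ → Pred A p → Pred A (a ⊔ ℓ ⊔ p)
  IsGreatest _≤_ P x = P x × (∀ y → P y → y ≤ x)

  IsSmallest : Rel A ℓ → Pred A p → Pred A (a ⊔ ℓ ⊔ p)
  IsSmallest _≤_ P x = P x × (∀ y → P y → x ≤ y)

module _ {A : Set a} (_≈_ : Rel A ℓ)
         (_∧_ _∨_ : Op₂ A) (¬_ D : Op₁ A) (0# 1# : A) where

  open NaturalOrder _≈_ _∧_ using (_≤_)

  record IsDPAlgebra : Set (a ⊔ ℓ) where
    field
      isDistributiveLattice : IsDistributiveLattice _≈_ _∨_ _∧_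
      ∨-identity            : Identity _≈_ 0# _∨_
      ∧-identity            : Identity _≈_ 1# _∧_
      ¬-greatest            : ∀ x → IsGreatest _≤_ (λ y → (x ∧ y) ≈ 0#) (¬ x)
      D-smallest            : ∀ x → IsSmallest _≤_ (λ y → (x ∨ y) ≈ 1#) (D x)

  record IsRegularDPAlgebra : Set (a ⊔ ℓ) where
    field
      isDPAlgebra : IsDPAlgebra
      regular     : ∀ x y → (x ∧ D x) ≤ (y ∨ (¬ y))

  record IsThreeValuedDPAlgebra : Set (a ⊔ ℓ) where
    field
      isRegularDPAlgebra : IsRegularDPAlgebra
      ¬-stone            : ∀ x → ((¬ x) ∨ (¬ (¬ x))) ≈ 1#
      D-stone            : ∀ x → (D x ∧ D (D x)) ≈ 0#

record IsC3DPAlgebra (𝐀 : Algebra ℓ) : Set ℓ where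
  open Algebra 𝐀
  field
    isThreeValuedDPAlgebra : IsThreeValuedDPAlgebra _≈_ _∧_ _∨_ ¬_ D 0# 1#
    ¬c≈0                   : ¬ c ≈ 0#
    Dc≈1                   : D c ≈ 1#

C3DP : Class ℓ ℓ
C3DP = IsC3DPAlgebra

-- Two contracts are equal when their components are;
-- the proof that the components join to 1 is ignored.

module _ (𝐁 : BooleanAlgebra ℓ ℓ) where

  private
    module B = BooleanAlgebra 𝐁
    open B using (_≈_) renaming (Carrier to B; _∧_ to _∩_; _∨_ to _∪_; ¬_ to _′; ⊤ to 1B; ⊥ to 0B)
    open BooleanAlgebraProperties 𝐁 using (∨-zeroˡ; ∨-zeroʳ; ∧-identityʳ)
    open SetoidReasoning B.setoid

    ∪-∩-lemma : ∀ {a b c d} → a ∪ b ≈ 1B → c ∪ d ≈ 1B → (a ∪ c) ∪ (b ∩ d) ≈ 1B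
    ∪-∩-lemma {a} {b} {c} {d} p q = begin
      (a ∪ c) ∪ (b ∩ d)             ≈⟨ B.∨-distribˡ-∧ (a ∪ c) b d ⟩
      ((a ∪ c) ∪ b) ∩ ((a ∪ c) ∪ d) ≈⟨ B.∧-cong left right ⟩
      1B ∩ 1B                       ≈⟨ ∧-identityʳ 1B ⟩
      1B                            ∎
      where
      left : (a ∪ c) ∪ b ≈ 1B
      left = begin
        (a ∪ c) ∪ b ≈⟨ B.∨-cong (B.∨-comm a c) B.refl ⟩
        (c ∪ a) ∪ b ≈⟨ B.∨-assoc c a b ⟩
        c ∪ (a ∪ b) ≈⟨ B.∨-cong B.refl p ⟩
        c ∪ 1B      ≈⟨ ∨-zeroʳ c ⟩
        1B          ∎
      right : (a ∪ c) ∪ d ≈ 1B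
      right = begin
        (a ∪ c) ∪ d ≈⟨ B.∨-assoc a c d ⟩
        a ∪ (c ∪ d) ≈⟨ B.∨-cong B.refl q ⟩
        a ∪ 1B      ≈⟨ ∨-zeroʳ a ⟩
        1B          ∎

    ∩-∪-lemma : ∀ {a b c d} → a ∪ b ≈ 1B → c ∪ d ≈ 1B → (a ∩ c) ∪ (b ∪ d) ≈ 1B
    ∩-∪-lemma {a} {b} {c} {d} p q = begin
      (a ∩ c) ∪ (b ∪ d) ≈⟨ B.∨-comm (a ∩ c) (b ∪ d) ⟩
      (b ∪ d) ∪ (a ∩ c) ≈⟨ ∪-∩-lemma (B.trans (B.∨-comm b a) p)
                                     (B.trans (B.∨-comm d c) q) ⟩
      1B                ∎

  Contract : Set ℓ
  Contract = Σ (B × B) λ (a , b) → a ∪ b ≈ 1B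

  contractAlgebra : Algebra ℓ
  contractAlgebra = record
    { Carrier       = Contract
    ; _≈_           = λ ((a , b) , _) ((c , d) , _) → a ≈ c × b ≈ d
    ; _∧_           = λ ((a , b) , p) ((c , d) , q) → (a ∪ c , b ∩ d) , ∪-∩-lemma p q
    ; _∨_           = λ ((a , b) , p) ((c , d) , q) → (a ∩ c , b ∪ d) , ∩-∪-lemma p q
    ; ¬_            = λ ((a , b) , _) → (b , b ′) , B.∨-complementʳ b
    ; D             = λ ((a , b) , _) → (a ′ , a) , B.∨-complementˡ a
    ; 0#            = (1B , 0B) , ∨-zeroˡ 0B
    ; c             = (1B , 1B) , ∨-zeroˡ 1B
    ; 1#            = (0B , 1B) , ∨-zeroʳ 0B
    ; isEquivalence = record
      { refl  = B.refl , B.refl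
      ; sym   = λ (e , f) → B.sym e , B.sym f
      ; trans = λ (e , f) (e′ , f′) → B.trans e e′ , B.trans f f′
      }
    ; ∧-cong        = λ (e , f) (e′ , f′) → B.∨-cong e e′ , B.∧-cong f f′
    ; ∨-cong        = λ (e , f) (e′ , f′) → B.∧-cong e e′ , B.∨-cong f f′
    ; ¬-cong        = λ (e , f) → f , B.¬-cong f
    ; D-cong        = λ (e , f) → B.¬-cong e , e
    }

data ContractAlgebras {ℓ} : Class ℓ (suc ℓ) where
  𝐂 : (𝐁 : BooleanAlgebra ℓ ℓ) → ContractAlgebras (contractAlgebra 𝐁)

{-# OPTIONS --safe #-}

-- The greatest condition on ¬ amounts to the identities ¬ 0 = 1, ¬ 1 = 0 and
-- x ∧ ¬ (x ∧ y) = x ∧ ¬ y, and dually for D, so C3DP is an equational class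
-- and hence a variety; contract algebras satisfy its identities.
-- Conversely, the elements x = ¬ ¬ x of a c3dp-algebra A form a Boolean
-- algebra B, and x ↦ (D x , ¬ ¬ x) is an isomorphism A → C(B): it is
-- injective by regularity, and (a , b) is the image of (b ∧ c) ∨ ¬ a.
-- So every c3dp-algebra is a homomorphic image of a contract algebra.

module Submission where

open import Defs
open import Level using (Level; _⊔_; suc; 0ℓ)

open import Algebra.Core using (Op₁)
open import Algebra.Definitions using (Congruent₁; RightIdentity; RightZero)
open import Algebra.Lattice.Bundles using (BooleanAlgebra; DistributiveLattice)
open import Algebra.Lattice.Structures using (IsDistributiveLattice)
import Algebra.Consequences.Setoid as Consequences
import Algebra.Lattice.Properties.BooleanAlgebra as BooleanAlgebraProperties
import Algebra.Lattice.Properties.DistributiveLattice as DistributiveLatticeProperties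
open import Data.Fin.Base using (Fin)
open import Data.Fin.Patterns using (0F; 1F; 2F)
open import Data.Product using (Σ; _,_; proj₁; proj₂)
open import Function.Base using (_∘_; id)
open import Function.Definitions using (Injective; Surjective)
open import Relation.Binary.Bundles using (Setoid)
open import Relation.Binary.Core using (Rel)
open import Relation.Binary.Lattice.Bundles using (Lattice)
import Relation.Binary.Lattice.Properties.JoinSemilattice as JoinSemilatticeProperties
import Relation.Binary.Lattice.Properties.MeetSemilattice as MeetSemilatticeProperties
import Relation.Binary.Reasoning.PartialOrder as PartialOrderReasoning
import Relation.Binary.Reasoning.Setoid as SetoidReasoning
open import Relation.Unary using (Pred; _⊆_)

private
  variable
    a ℓ p : Level

-- Identities in three variables, and closure of their model classes under images, subalgebras and
-- products.

module Equations where

  infix  8 ¬_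
  infixr 7 _∧_
  infixr 6 _∨_

  -- Three variables are enough for every identity in `Axiom`.
  data Term : Set where
    var      : Fin 3 → Term
    _∧_ _∨_  : Term → Term → Term
    ¬_ D     : Term → Term
    0# c 1#  : Term

  module _ (𝐀 : Algebra ℓ) where
    private module A = Algebra 𝐀

    eval : (Fin 3 → A.Carrier) → Term → A.Carrier
    eval ρ (var i) = ρ i
    eval ρ (s ∧ t) = eval ρ s A.∧ eval ρ t
    eval ρ (s ∨ t) = eval ρ s A.∨ eval ρ t
    eval ρ (¬ t)   = A.¬ eval ρ t
    eval ρ (D t)   = A.D (eval ρ t)
    eval ρ 0#      = A.0#
    eval ρ c       = A.c
    eval ρ 1#      = A.1#

    eval-cong : ∀ {ρ σ} → (∀ i → ρ i A.≈ σ i) → ∀ t → eval ρ t A.≈ eval σ t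
    eval-cong e (var i) = e i
    eval-cong e (s ∧ t) = A.∧-cong (eval-cong e s) (eval-cong e t)
    eval-cong e (s ∨ t) = A.∨-cong (eval-cong e s) (eval-cong e t)
    eval-cong e (¬ t)   = A.¬-cong (eval-cong e t)
    eval-cong e (D t)   = A.D-cong (eval-cong e t)
    eval-cong e 0#      = A.refl
    eval-cong e c       = A.refl
    eval-cong e 1#      = A.refl

  infix 4 _⊨_≈_

  _⊨_≈_ : Algebra ℓ → Term → Term → Set ℓ
  𝐀 ⊨ s ≈ t = ∀ ρ → Algebra._≈_ 𝐀 (eval 𝐀 ρ s) (eval 𝐀 ρ t)

  Models : Rel Term p → Class ℓ (ℓ ⊔ p)
  Models E 𝐀 = ∀ {s t} → E s t → 𝐀 ⊨ s ≈ t

  module _ {𝐀 𝐁 : Algebra ℓ} {f : Algebra.Carrier 𝐀 → Algebra.Carrier 𝐁}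
           (hom : IsHomomorphism 𝐀 𝐁 f) where
    private module B = Algebra 𝐁
    open IsHomomorphism hom

    eval-homo : ∀ ρ t → f (eval 𝐀 ρ t) B.≈ eval 𝐁 (f ∘ ρ) t
    eval-homo ρ (var i) = B.refl
    eval-homo ρ (s ∧ t) = B.trans (∧-homo _ _) (B.∧-cong (eval-homo ρ s) (eval-homo ρ t))
    eval-homo ρ (s ∨ t) = B.trans (∨-homo _ _) (B.∨-cong (eval-homo ρ s) (eval-homo ρ t))
    eval-homo ρ (¬ t)   = B.trans (¬-homo _) (B.¬-cong (eval-homo ρ t))
    eval-homo ρ (D t)   = B.trans (D-homo _) (B.D-cong (eval-homo ρ t))
    eval-homo ρ 0#      = 0-homo
    eval-homo ρ c       = c-homo
    eval-homo ρ 1#      = 1-homo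

    -- The conclusion is stated under `f` because equality in a subalgebra is equality after
    -- inclusion, and equality in a product is equality after every projection. Closure under S and
    -- P are then both instances.
    codomain-⊨ : ∀ s t → 𝐁 ⊨ s ≈ t →
                 ∀ ρ → f (eval 𝐀 ρ s) B.≈ f (eval 𝐀 ρ t)
    codomain-⊨ s t s≈t ρ =
      B.trans (eval-homo ρ s) (B.trans (s≈t (f ∘ ρ)) (B.sym (eval-homo ρ t)))

    image-⊨ : Surjective (Algebra._≈_ 𝐀) B._≈_ f →
              ∀ s t → 𝐀 ⊨ s ≈ t → 𝐁 ⊨ s ≈ t
    image-⊨ surj s t s≈t ρ =
      B.trans (lift s) (B.trans (cong (s≈t σ)) (B.sym (lift t)))
      where
      -- `Surjective` carries chosen preimages, so the assignment lifts variable by variable.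
      σ : Fin 3 → Algebra.Carrier 𝐀
      σ i = proj₁ (surj (ρ i))
      lift : ∀ u → eval 𝐁 ρ u B.≈ f (eval 𝐀 σ u)
      lift u = B.trans
        (eval-cong 𝐁 (λ i → B.sym (proj₂ (surj (ρ i)) (Algebra.refl 𝐀))) u)
        (B.sym (eval-homo σ u))

  inclusion-isHomomorphism : (𝐀 : Algebra ℓ) (S : Pred (Algebra.Carrier 𝐀) ℓ)
                             (isSub : IsSubuniverse 𝐀 S) →
                             IsHomomorphism (subalgebra 𝐀 S isSub) 𝐀 proj₁
  inclusion-isHomomorphism 𝐀 S isSub = record
    { cong   = id
    ; ∧-homo = λ _ _ → refl
    ; ∨-homo = λ _ _ → refl
    ; ¬-homo = λ _ → refl
    ; D-homo = λ _ → refl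
    ; 0-homo = refl
    ; c-homo = refl
    ; 1-homo = refl
    }
    where open Algebra 𝐀

  projection-isHomomorphism : (I : Set ℓ) (𝐀 : I → Algebra ℓ) (i : I) →
                              IsHomomorphism (product I 𝐀) (𝐀 i) (λ x → x i)
  projection-isHomomorphism I 𝐀 i = record
    { cong   = λ e → e i
    ; ∧-homo = λ _ _ → refl
    ; ∨-homo = λ _ _ → refl
    ; ¬-homo = λ _ → refl
    ; D-homo = λ _ → refl
    ; 0-homo = refl
    ; c-homo = refl
    ; 1-homo = refl
    }
    where open Algebra (𝐀 i)

  Models-isVariety : (E : Rel Term p) → IsVariety {ℓ} (Models E)
  Models-isVariety E = record
    { H-closed = λ f hom surj m {s} {t} e → image-⊨ hom surj s t (m e)
    ; S-closed = λ {𝐀} S isSub m {s} {t} e →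
        codomain-⊨ (inclusion-isHomomorphism 𝐀 S isSub) s t (m e)
    ; P-closed = λ I 𝐀 m {s} {t} e ρ i →
        codomain-⊨ (projection-isHomomorphism I 𝐀 i) s t (m i e) ρ
    }

  -- Carries closure over from `Models Axiom` to `C3DP`, whose definition by greatest and smallest
  -- elements is not equational in form.
  IsVariety-resp-≐ : ∀ {q} {V : Class ℓ p} {W : Class ℓ q} →
                     V ⊆ W → W ⊆ V → IsVariety V → IsVariety W
  IsVariety-resp-≐ V⊆W W⊆V isVar = record
    { H-closed = λ f hom surj w → V⊆W (H-closed f hom surj (W⊆V w))
    ; S-closed = λ S isSub w → V⊆W (S-closed S isSub (W⊆V w))
    ; P-closed = λ I 𝐀 w → V⊆W (P-closed I 𝐀 (λ i → W⊆V (w i)))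
    }
    where open IsVariety isVar

  env : {A : Set a} → A → A → A → Fin 3 → A
  env u v w 0F = u
  env u v w 1F = v
  env u v w 2F = w

  private
    pattern x = var 0F
    pattern y = var 1F
    pattern z = var 2F

  -- `regular` writes the inequality `u ≤ v` as `u = u ∧ v`, which is what the natural order unfolds
  -- to.
  data Axiom : Rel Term 0ℓ where
    ∧-comm      : Axiom (x ∧ y) (y ∧ x)
    ∧-assoc     : Axiom ((x ∧ y) ∧ z) (x ∧ (y ∧ z))
    ∨-comm      : Axiom (x ∨ y) (y ∨ x)
    ∨-assoc     : Axiom ((x ∨ y) ∨ z) (x ∨ (y ∨ z))
    ∨-absorbs-∧ : Axiom (x ∨ (x ∧ y)) x
    ∧-absorbs-∨ : Axiom (x ∧ (x ∨ y)) x
    ∨-distrib-∧ : Axiom (x ∨ (y ∧ z)) ((x ∨ y) ∧ (x ∨ z))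
    ∧-distrib-∨ : Axiom (x ∧ (y ∨ z)) ((x ∧ y) ∨ (x ∧ z))
    ∨-identity  : Axiom (x ∨ 0#) x
    ∧-identity  : Axiom (x ∧ 1#) x
    ¬-relative  : Axiom (x ∧ ¬ (x ∧ y)) (x ∧ ¬ y)
    ¬0≈1        : Axiom (¬ 0#) 1#
    ¬1≈0        : Axiom (¬ 1#) 0#
    D-relative  : Axiom (x ∨ D (x ∨ y)) (x ∨ D y)
    D1≈0        : Axiom (D 1#) 0#
    D0≈1        : Axiom (D 0#) 1#
    regular     : Axiom (x ∧ D x) ((x ∧ D x) ∧ (y ∨ ¬ y))
    ¬-stone     : Axiom (¬ x ∨ ¬ ¬ x) 1#
    D-stone     : Axiom (D x ∧ D (D x)) 0#
    ¬c≈0        : Axiom (¬ c) 0#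
    Dc≈1        : Axiom (D c) 1#

open Equations using (Models; Models-isVariety; IsVariety-resp-≐; Axiom; env; eval)

-- Pseudocomplements in distributive lattices.

module DistributiveLatticeOrder (L : DistributiveLattice a ℓ) where
  open DistributiveLattice L public
  open DistributiveLatticeProperties L using (∨-∧-orderTheoreticLattice)
  open Lattice ∨-∧-orderTheoreticLattice public
    using ( _≤_; poset; antisym; x∧y≤x; x∧y≤y; ∧-greatest; x≤x∨y; y≤x∨y; ∨-least
          ; meetSemilattice; joinSemilattice)
    renaming (refl to ≤-refl; trans to ≤-trans; reflexive to ≤-reflexive)
  open MeetSemilatticeProperties meetSemilattice public using (∧-monotonic)
  open JoinSemilatticeProperties joinSemilattice public using (∨-monotonic)

module _ (L : DistributiveLattice a ℓ) where
  open DistributiveLatticeOrder L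

  -- Lattice and bounds are parameters so that `D` is covered too, as a pseudocomplement in the
  -- order dual with the bounds exchanged.
  record IsPseudocomplement (¬_ : Op₁ Carrier) (⊥ ⊤ : Carrier) : Set (a ⊔ ℓ) where
    field
      ∨-identityʳ   : RightIdentity _≈_ ⊥ _∨_
      ∧-identityʳ   : RightIdentity _≈_ ⊤ _∧_
      ∧-complementʳ : ∀ x → (x ∧ (¬ x)) ≈ ⊥
      ¬-greatest    : ∀ x y → (x ∧ y) ≈ ⊥ → y ≤ (¬ x)

    open SetoidReasoning setoid

    ∧-zeroʳ : RightZero _≈_ ⊥ _∧_
    ∧-zeroʳ x = begin
      x ∧ ⊥       ≈⟨ ∧-comm x ⊥ ⟩
      ⊥ ∧ x       ≈⟨ ∧-congˡ (∨-identityʳ x) ⟨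
      ⊥ ∧ (x ∨ ⊥) ≈⟨ ∧-congˡ (∨-comm x ⊥) ⟩
      ⊥ ∧ (⊥ ∨ x) ≈⟨ ∧-absorbs-∨ ⊥ x ⟩
      ⊥           ∎

    ¬⊥≈⊤ : (¬ ⊥) ≈ ⊤
    ¬⊥≈⊤ = antisym (sym (∧-identityʳ _)) (¬-greatest ⊥ ⊤ (∧-identityʳ ⊥))

    ¬⊤≈⊥ : (¬ ⊤) ≈ ⊥
    ¬⊤≈⊥ = trans (sym (∧-identityʳ _)) (trans (∧-comm _ _) (∧-complementʳ ⊤))

    -- Both sides lie below `x`, and an element below `x` is disjoint from `x ∧ y` exactly when it
    -- is disjoint from `y`.
    ¬-relative : ∀ x y → (x ∧ (¬ (x ∧ y))) ≈ (x ∧ (¬ y))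
    ¬-relative x y = antisym
      (∧-greatest (x∧y≤x _ _) (¬-greatest y _ (begin
        y ∧ (x ∧ (¬ (x ∧ y))) ≈⟨ ∧-assoc _ _ _ ⟨
        (y ∧ x) ∧ (¬ (x ∧ y)) ≈⟨ ∧-congʳ (∧-comm y x) ⟩
        (x ∧ y) ∧ (¬ (x ∧ y)) ≈⟨ ∧-complementʳ _ ⟩
        ⊥                     ∎)))
      (∧-greatest (x∧y≤x _ _) (≤-trans (x∧y≤y _ _) (¬-greatest (x ∧ y) _ (begin
        (x ∧ y) ∧ (¬ y) ≈⟨ ∧-assoc _ _ _ ⟩
        x ∧ (y ∧ (¬ y)) ≈⟨ ∧-congˡ (∧-complementʳ y) ⟩
        x ∧ ⊥           ≈⟨ ∧-zeroʳ x ⟩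
        ⊥               ∎))))

-- Stone algebras, presented by identities, and their Boolean skeletons.

record StoneAlgebra a ℓ : Set (suc (a ⊔ ℓ)) where
  infix 8 ¬_
  field
    distributiveLattice : DistributiveLattice a ℓ
  open DistributiveLattice distributiveLattice public
  field
    ¬_          : Op₁ Carrier
    ⊥ ⊤         : Carrier
    ¬-cong      : Congruent₁ _≈_ ¬_
    ∨-identityʳ : RightIdentity _≈_ ⊥ _∨_
    ∧-identityʳ : RightIdentity _≈_ ⊤ _∧_
    -- Together with the values of `¬` at the bounds, this replaces the universal property of the
    -- pseudocomplement, which `∧-complementʳ` and `¬-greatest` recover.
    ¬-relative  : ∀ x y → x ∧ ¬ (x ∧ y) ≈ x ∧ ¬ y
    ¬⊥≈⊤        : ¬ ⊥ ≈ ⊤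
    ¬⊤≈⊥        : ¬ ⊤ ≈ ⊥
    stone       : ∀ x → ¬ x ∨ ¬ ¬ x ≈ ⊤

module StoneAlgebraProperties (𝐒 : StoneAlgebra a ℓ) where
  open StoneAlgebra 𝐒
  open DistributiveLatticeOrder distributiveLattice public
    using ( _≤_; poset; antisym; x∧y≤x; x∧y≤y; ∧-greatest; x≤x∨y; y≤x∨y; ∨-least
          ; ∧-monotonic; ∨-monotonic; ≤-refl; ≤-trans; ≤-reflexive)
  open PartialOrderReasoning poset

  ≤⊤ : ∀ x → x ≤ ⊤
  ≤⊤ x = sym (∧-identityʳ x)

  ⊥≤ : ∀ x → ⊥ ≤ x
  ⊥≤ x = ≤-trans (y≤x∨y x ⊥) (≤-reflexive (∨-identityʳ x))

  ≤⊥⇒≈⊥ : ∀ {x} → x ≤ ⊥ → x ≈ ⊥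
  ≤⊥⇒≈⊥ x≤⊥ = antisym x≤⊥ (⊥≤ _)

  ∧-complementʳ : ∀ x → x ∧ ¬ x ≈ ⊥
  ∧-complementʳ x = begin-equality
    x ∧ ¬ x       ≈⟨ ∧-congˡ (¬-cong (∧-identityʳ x)) ⟨
    x ∧ ¬ (x ∧ ⊤) ≈⟨ ¬-relative x ⊤ ⟩
    x ∧ ¬ ⊤       ≈⟨ ∧-congˡ ¬⊤≈⊥ ⟩
    x ∧ ⊥         ≈⟨ ≤⊥⇒≈⊥ (x∧y≤y x ⊥) ⟩
    ⊥             ∎

  -- Disjointness makes `¬ (y ∧ x)` equal to `⊤`, so `¬-relative` reads `y = y ∧ ¬ x`.
  ¬-greatest : ∀ {x y} → x ∧ y ≈ ⊥ → y ≤ ¬ x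
  ¬-greatest {x} {y} x∧y≈⊥ = begin-equality
    y             ≈⟨ ∧-identityʳ y ⟨
    y ∧ ⊤         ≈⟨ ∧-congˡ ¬⊥≈⊤ ⟨
    y ∧ ¬ ⊥       ≈⟨ ∧-congˡ (¬-cong (trans (∧-comm y x) x∧y≈⊥)) ⟨
    y ∧ ¬ (y ∧ x) ≈⟨ ¬-relative y x ⟩
    y ∧ ¬ x       ∎

  ¬-antitone : ∀ {x y} → x ≤ y → ¬ y ≤ ¬ x
  ¬-antitone {x} {y} x≤y = ¬-greatest (≤⊥⇒≈⊥ (begin
    x ∧ ¬ y ≤⟨ ∧-monotonic x≤y ≤-refl ⟩
    y ∧ ¬ y ≈⟨ ∧-complementʳ y ⟩
    ⊥       ∎))

  x≤¬¬x : ∀ x → x ≤ ¬ ¬ x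
  x≤¬¬x x = ¬-greatest (trans (∧-comm _ _) (∧-complementʳ x))

  ¬¬¬x≈¬x : ∀ x → ¬ ¬ ¬ x ≈ ¬ x
  ¬¬¬x≈¬x x = antisym (¬-antitone (x≤¬¬x x)) (x≤¬¬x (¬ x))

  ¬-∨ : ∀ x y → ¬ (x ∨ y) ≈ ¬ x ∧ ¬ y
  ¬-∨ x y = antisym
    (∧-greatest (¬-antitone (x≤x∨y x y)) (¬-antitone (y≤x∨y x y)))
    (¬-greatest (≤⊥⇒≈⊥ (begin
      (x ∨ y) ∧ (¬ x ∧ ¬ y)               ≈⟨ ∧-distribʳ-∨ _ x y ⟩
      x ∧ (¬ x ∧ ¬ y) ∨ y ∧ (¬ x ∧ ¬ y)   ≤⟨ ∨-monotonic (∧-monotonic ≤-refl (x∧y≤x _ _))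
                                                         (∧-monotonic ≤-refl (x∧y≤y _ _)) ⟩
      x ∧ ¬ x ∨ y ∧ ¬ y                   ≈⟨ ∨-cong (∧-complementʳ x) (∧-complementʳ y) ⟩
      ⊥ ∨ ⊥                               ≈⟨ ∨-identityʳ ⊥ ⟩
      ⊥                                   ∎)))

  -- The Stone identity splits `¬ (x ∧ y)` into a part below `¬ x` and a part below `¬ ¬ x`. The
  -- second part is disjoint from `y`, because `y ∧ ¬ (x ∧ y)` lies below `¬ x`.
  ¬-∧ : ∀ x y → ¬ (x ∧ y) ≈ ¬ x ∨ ¬ y
  ¬-∧ x y = antisym
    (begin
      n                     ≈⟨ ∧-identityʳ n ⟨
      n ∧ ⊤                 ≈⟨ ∧-congˡ (stone x) ⟨
      n ∧ (¬ x ∨ ¬ ¬ x)     ≈⟨ ∧-distribˡ-∨ n _ _ ⟩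
      n ∧ ¬ x ∨ n ∧ ¬ ¬ x   ≤⟨ ∨-monotonic (x∧y≤y n _) n∧¬¬x≤¬y ⟩
      ¬ x ∨ ¬ y             ∎)
    (∨-least (¬-antitone (x∧y≤x x y)) (¬-antitone (x∧y≤y x y)))
    where
    n = ¬ (x ∧ y)
    y∧n≤¬x : y ∧ n ≤ ¬ x
    y∧n≤¬x = ¬-greatest (trans (sym (∧-assoc x y n)) (∧-complementʳ (x ∧ y)))
    n∧¬¬x≤¬y : n ∧ ¬ ¬ x ≤ ¬ y
    n∧¬¬x≤¬y = ¬-greatest (≤⊥⇒≈⊥ (begin
      y ∧ (n ∧ ¬ ¬ x) ≈⟨ ∧-assoc y n _ ⟨
      (y ∧ n) ∧ ¬ ¬ x ≤⟨ ∧-monotonic y∧n≤¬x ≤-refl ⟩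
      ¬ x ∧ ¬ ¬ x     ≈⟨ ∧-complementʳ (¬ x) ⟩
      ⊥               ∎))

  ¬¬-∧ : ∀ x y → ¬ ¬ (x ∧ y) ≈ ¬ ¬ x ∧ ¬ ¬ y
  ¬¬-∧ x y = trans (¬-cong (¬-∧ x y)) (¬-∨ (¬ x) (¬ y))

  -- Lets the skeleton keep the join of the algebra. Without the Stone identity its join would have
  -- to be `¬ ¬ (x ∨ y)`.
  ¬¬-∨ : ∀ x y → ¬ ¬ (x ∨ y) ≈ ¬ ¬ x ∨ ¬ ¬ y
  ¬¬-∨ x y = trans (¬-cong (¬-∨ x y)) (¬-∧ (¬ x) (¬ y))

  Skeleton : Set (a ⊔ ℓ)
  Skeleton = Σ Carrier λ x → ¬ ¬ x ≈ x

  skeleton : BooleanAlgebra (a ⊔ ℓ) ℓ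
  skeleton = record
    { Carrier          = Skeleton
    ; _≈_              = λ (x , _) (y , _) → x ≈ y
    ; _∨_              = λ (x , p) (y , q) → x ∨ y , trans (¬¬-∨ x y) (∨-cong p q)
    ; _∧_              = λ (x , p) (y , q) → x ∧ y , trans (¬¬-∧ x y) (∧-cong p q)
    ; ¬_               = λ (x , _) → ¬ x , ¬¬¬x≈¬x x
    ; ⊤                = ⊤ , trans (¬-cong ¬⊤≈⊥) ¬⊥≈⊤
    ; ⊥                = ⊥ , trans (¬-cong ¬⊥≈⊤) ¬⊤≈⊥
    ; isBooleanAlgebra = record
      { isDistributiveLattice = record
        { isLattice = record
          { isEquivalence = record { refl = refl ; sym = sym ; trans = trans }
          ; ∨-comm        = λ _ _ → ∨-comm _ _
          ; ∨-assoc       = λ _ _ _ → ∨-assoc _ _ _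
          ; ∨-cong        = ∨-cong
          ; ∧-comm        = λ _ _ → ∧-comm _ _
          ; ∧-assoc       = λ _ _ _ → ∧-assoc _ _ _
          ; ∧-cong        = ∧-cong
          ; absorptive    = (λ _ _ → ∨-absorbs-∧ _ _) , (λ _ _ → ∧-absorbs-∨ _ _)
          }
        ; ∨-distrib-∧ = (λ _ _ _ → ∨-distribˡ-∧ _ _ _) , (λ _ _ _ → ∨-distribʳ-∧ _ _ _)
        ; ∧-distrib-∨ = (λ _ _ _ → ∧-distribˡ-∨ _ _ _) , (λ _ _ _ → ∧-distribʳ-∨ _ _ _)
        }
      -- Replacing `x` by `¬ ¬ x`, which equals it here, turns both laws into the Stone identity.
      ; ∨-complement =
          (λ (x , p) → trans (∨-congˡ (sym p)) (stone x)) ,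
          (λ (x , p) → trans (∨-congʳ (sym p)) (trans (∨-comm _ _) (stone x)))
      ; ∧-complement =
          (λ (x , _) → trans (∧-comm _ _) (∧-complementʳ x)) ,
          (λ (x , _) → ∧-complementʳ x)
      ; ¬-cong = ¬-cong
      }
    }

-- From the order-theoretic definition of c3dp-algebras to the identities.

module _ (𝐀 : Algebra ℓ) (isC3DP : C3DP 𝐀) where
  open Algebra 𝐀
  open IsC3DPAlgebra isC3DP
  open IsThreeValuedDPAlgebra isThreeValuedDPAlgebra
  open IsRegularDPAlgebra isRegularDPAlgebra
  open IsDPAlgebra isDPAlgebra

  private
    L : DistributiveLattice ℓ ℓ
    L = record { isDistributiveLattice = isDistributiveLattice }

    module L = DistributiveLatticeOrder L
    module Lᵈ = DistributiveLatticeProperties L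

    ¬-isPseudocomplement : IsPseudocomplement L ¬_ 0# 1#
    ¬-isPseudocomplement = record
      { ∨-identityʳ   = proj₂ ∨-identity
      ; ∧-identityʳ   = proj₂ ∧-identity
      ; ∧-complementʳ = λ x → proj₁ (¬-greatest x)
      ; ¬-greatest    = λ x → proj₂ (¬-greatest x)
      }

    D-isPseudocomplement : IsPseudocomplement Lᵈ.∧-∨-distributiveLattice D 1# 0#
    D-isPseudocomplement = record
      { ∨-identityʳ   = proj₂ ∧-identity
      ; ∧-identityʳ   = proj₂ ∨-identity
      ; ∧-complementʳ = λ x → proj₁ (D-smallest x)
      -- The dual order unfolds to `y = y ∨ D x`, while minimality of `D x` is given as
      -- `D x = D x ∧ y`. Absorption passes from one to the other.
      ; ¬-greatest    = λ x y x∨y≈1 → begin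
          y             ≈⟨ L.∨-absorbs-∧ y (D x) ⟨
          y ∨ (y ∧ D x) ≈⟨ L.∨-congˡ (L.∧-comm y (D x)) ⟩
          y ∨ (D x ∧ y) ≈⟨ L.∨-congˡ (proj₂ (D-smallest x) y x∨y≈1) ⟨
          y ∨ D x       ∎
      }
      where open SetoidReasoning L.setoid

    module P  = IsPseudocomplement ¬-isPseudocomplement
    module Pᵈ = IsPseudocomplement D-isPseudocomplement

  C3DP⇒Models : Models Axiom 𝐀
  C3DP⇒Models Axiom.∧-comm      ρ = L.∧-comm _ _
  C3DP⇒Models Axiom.∧-assoc     ρ = L.∧-assoc _ _ _
  C3DP⇒Models Axiom.∨-comm      ρ = L.∨-comm _ _
  C3DP⇒Models Axiom.∨-assoc     ρ = L.∨-assoc _ _ _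
  C3DP⇒Models Axiom.∨-absorbs-∧ ρ = L.∨-absorbs-∧ _ _
  C3DP⇒Models Axiom.∧-absorbs-∨ ρ = L.∧-absorbs-∨ _ _
  C3DP⇒Models Axiom.∨-distrib-∧ ρ = L.∨-distribˡ-∧ _ _ _
  C3DP⇒Models Axiom.∧-distrib-∨ ρ = L.∧-distribˡ-∨ _ _ _
  C3DP⇒Models Axiom.∨-identity  ρ = P.∨-identityʳ _
  C3DP⇒Models Axiom.∧-identity  ρ = P.∧-identityʳ _
  C3DP⇒Models Axiom.¬-relative  ρ = P.¬-relative _ _
  C3DP⇒Models Axiom.¬0≈1        ρ = P.¬⊥≈⊤
  C3DP⇒Models Axiom.¬1≈0        ρ = P.¬⊤≈⊥
  C3DP⇒Models Axiom.D-relative  ρ = Pᵈ.¬-relative _ _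
  C3DP⇒Models Axiom.D1≈0        ρ = Pᵈ.¬⊥≈⊤
  C3DP⇒Models Axiom.D0≈1        ρ = Pᵈ.¬⊤≈⊥
  C3DP⇒Models Axiom.regular     ρ = regular _ _
  C3DP⇒Models Axiom.¬-stone     ρ = ¬-stone _
  C3DP⇒Models Axiom.D-stone     ρ = D-stone _
  C3DP⇒Models Axiom.¬c≈0        ρ = ¬c≈0
  C3DP⇒Models Axiom.Dc≈1        ρ = Dc≈1

-- From the identities back to c3dp-algebras, and the isomorphism with a contract algebra.

module C3DPProperties (𝐀 : Algebra ℓ) (models : Models Axiom 𝐀) where
  open Algebra 𝐀

  private
    law₁ : ∀ {s t} → Axiom s t →
           ∀ x → eval 𝐀 (env x x x) s ≈ eval 𝐀 (env x x x) t
    law₁ e x = models e (env x x x)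

    law₂ : ∀ {s t} → Axiom s t →
           ∀ x y → eval 𝐀 (env x y y) s ≈ eval 𝐀 (env x y y) t
    law₂ e x y = models e (env x y y)

    law₃ : ∀ {s t} → Axiom s t →
           ∀ x y z → eval 𝐀 (env x y z) s ≈ eval 𝐀 (env x y z) t
    law₃ e x y z = models e (env x y z)

    setoid : Setoid ℓ ℓ
    setoid = record { isEquivalence = isEquivalence }

  isDistributiveLattice : IsDistributiveLattice _≈_ _∨_ _∧_
  isDistributiveLattice = record
    { isLattice = record
      { isEquivalence = isEquivalence
      ; ∨-comm        = law₂ Axiom.∨-comm
      ; ∨-assoc       = law₃ Axiom.∨-assoc
      ; ∨-cong        = ∨-cong
      ; ∧-comm        = law₂ Axiom.∧-comm
      ; ∧-assoc       = law₃ Axiom.∧-assoc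
      ; ∧-cong        = ∧-cong
      ; absorptive    = law₂ Axiom.∨-absorbs-∧ , law₂ Axiom.∧-absorbs-∨
      }
    ; ∨-distrib-∧ = Consequences.comm∧distrˡ⇒distr setoid ∧-cong
                      (law₂ Axiom.∨-comm) (law₃ Axiom.∨-distrib-∧)
    ; ∧-distrib-∨ = Consequences.comm∧distrˡ⇒distr setoid ∨-cong
                      (law₂ Axiom.∧-comm) (law₃ Axiom.∧-distrib-∨)
    }

  distributiveLattice : DistributiveLattice ℓ ℓ
  distributiveLattice = record { isDistributiveLattice = isDistributiveLattice }

  stoneAlgebra : StoneAlgebra ℓ ℓ
  stoneAlgebra = record
    { distributiveLattice = distributiveLattice
    ; ¬_                  = ¬_
    ; ⊥                   = 0#
    ; ⊤                   = 1#
    ; ¬-cong              = ¬-cong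
    ; ∨-identityʳ         = law₁ Axiom.∨-identity
    ; ∧-identityʳ         = law₁ Axiom.∧-identity
    ; ¬-relative          = law₂ Axiom.¬-relative
    ; ¬⊥≈⊤                = law₁ Axiom.¬0≈1 0#
    ; ¬⊤≈⊥                = law₁ Axiom.¬1≈0 0#
    ; stone               = law₁ Axiom.¬-stone
    }

  -- Upside down, `D` is a pseudocomplement and `D-stone` is its Stone identity, so every fact about
  -- `¬` in Stone algebras has a counterpart for `D`.
  dualStoneAlgebra : StoneAlgebra ℓ ℓ
  dualStoneAlgebra = record
    { distributiveLattice =
        DistributiveLatticeProperties.∧-∨-distributiveLattice distributiveLattice
    ; ¬_                  = D
    ; ⊥                   = 1#
    ; ⊤                   = 0#
    ; ¬-cong              = D-cong
    ; ∨-identityʳ         = law₁ Axiom.∧-identity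
    ; ∧-identityʳ         = law₁ Axiom.∨-identity
    ; ¬-relative          = law₂ Axiom.D-relative
    ; ¬⊥≈⊤                = law₁ Axiom.D1≈0 0#
    ; ¬⊤≈⊥                = law₁ Axiom.D0≈1 0#
    ; stone               = law₁ Axiom.D-stone
    }

  open StoneAlgebra stoneAlgebra
    using ( ∧-comm; ∨-comm; ∧-congˡ; ∧-congʳ; ∨-congˡ; ∨-congʳ
          ; ∧-absorbs-∨; ∨-identityʳ; ∧-identityʳ; ∧-distribˡ-∨
          ; ¬⊥≈⊤; ¬⊤≈⊥; stone)
  open StoneAlgebraProperties stoneAlgebra
  private
    module Dual  = StoneAlgebra dualStoneAlgebra
    module Dualₚ = StoneAlgebraProperties dualStoneAlgebra
  open PartialOrderReasoning poset

  regular : ∀ x y → x ∧ D x ≤ y ∨ ¬ y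
  regular = law₂ Axiom.regular

  ¬c≈0 : ¬ c ≈ 0#
  ¬c≈0 = law₁ Axiom.¬c≈0 c

  Dc≈1 : D c ≈ 1#
  Dc≈1 = law₁ Axiom.Dc≈1 c

  x∨Dx≈1 : ∀ x → x ∨ D x ≈ 1#
  x∨Dx≈1 = Dualₚ.∧-complementʳ

  D-smallest : ∀ {x y} → x ∨ y ≈ 1# → D x ≤ y
  D-smallest {x} {y} x∨y≈1 = begin-equality
    D x             ≈⟨ ∧-absorbs-∨ (D x) y ⟨
    D x ∧ (D x ∨ y) ≈⟨ ∧-congˡ (∨-comm (D x) y) ⟩
    D x ∧ (y ∨ D x) ≈⟨ ∧-congˡ (Dualₚ.¬-greatest x∨y≈1) ⟨
    D x ∧ y         ∎

  isC3DPAlgebra : C3DP 𝐀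
  isC3DPAlgebra = record
    { isThreeValuedDPAlgebra = record
      { isRegularDPAlgebra = record
        { isDPAlgebra = record
          { isDistributiveLattice = isDistributiveLattice
          ; ∨-identity            = Consequences.comm∧idʳ⇒id setoid ∨-comm ∨-identityʳ
          ; ∧-identity            = Consequences.comm∧idʳ⇒id setoid ∧-comm ∧-identityʳ
          ; ¬-greatest            = λ x → ∧-complementʳ x , λ _ → ¬-greatest
          ; D-smallest            = λ x → x∨Dx≈1 x , λ _ → D-smallest
          }
        ; regular = regular
        }
      ; ¬-stone = stone
      ; D-stone = Dual.stone
      }
    ; ¬c≈0 = ¬c≈0
    ; Dc≈1 = Dc≈1
    }

  -- Split `¬ x` along `x ∨ D x = 1`: the part inside `x` vanishes.
  ¬x≤Dx : ∀ x → ¬ x ≤ D x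
  ¬x≤Dx x = begin
    ¬ x                   ≈⟨ ∧-identityʳ _ ⟨
    ¬ x ∧ 1#              ≈⟨ ∧-congˡ (x∨Dx≈1 x) ⟨
    ¬ x ∧ (x ∨ D x)       ≈⟨ ∧-distribˡ-∨ _ _ _ ⟩
    ¬ x ∧ x ∨ ¬ x ∧ D x   ≈⟨ ∨-congʳ (trans (∧-comm _ _) (∧-complementʳ x)) ⟩
    0# ∨ ¬ x ∧ D x        ≤⟨ ∨-least (⊥≤ _) (x∧y≤y _ _) ⟩
    D x                   ∎

  -- The dual Stone identity says that `D (D x)` is disjoint from `D x`, which bounds it by `¬ D x`.
  ¬Dx≈DDx : ∀ x → ¬ D x ≈ D (D x)
  ¬Dx≈DDx x = antisym (¬x≤Dx (D x)) (¬-greatest (Dual.stone x))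

  D¬x≈¬¬x : ∀ x → D (¬ x) ≈ ¬ ¬ x
  D¬x≈¬¬x x = antisym (D-smallest (stone x)) (¬x≤Dx (¬ x))

  ¬¬Dx≈Dx : ∀ x → ¬ ¬ D x ≈ D x
  ¬¬Dx≈Dx x = begin-equality
    ¬ ¬ D x     ≈⟨ ¬-cong (¬Dx≈DDx x) ⟩
    ¬ D (D x)   ≈⟨ ¬Dx≈DDx (D x) ⟩
    D (D (D x)) ≈⟨ Dualₚ.¬¬¬x≈¬x x ⟩
    D x         ∎

  -- In `C(B)`, `D (a , b)` is `(a ′ , a)` and `¬ ¬ (a , b)` is `(b ′ , b)`. With `u` identified
  -- with `(u ′ , u)`, these are the two components of the contract.
  toContract : Carrier → Contract skeleton
  toContract x = ((D x , ¬¬Dx≈Dx x) , (¬ ¬ x , ¬¬¬x≈¬x (¬ x))) ,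
    antisym (≤⊤ _) (begin
      1#          ≈⟨ x∨Dx≈1 x ⟨
      x ∨ D x     ≈⟨ ∨-comm _ _ ⟩
      D x ∨ x     ≤⟨ ∨-monotonic ≤-refl (x≤¬¬x x) ⟩
      D x ∨ ¬ ¬ x ∎)

  -- `D` exchanges meets and joins, which matches the reversed order on first components, while
  -- `¬ ¬` preserves both.
  toContract-isHomomorphism : IsHomomorphism 𝐀 (contractAlgebra skeleton) toContract
  toContract-isHomomorphism = record
    { cong   = λ e → D-cong e , ¬-cong (¬-cong e)
    ; ∧-homo = λ x y → Dualₚ.¬-∨ x y , ¬¬-∧ x y
    ; ∨-homo = λ x y → Dualₚ.¬-∧ x y , ¬¬-∨ x y
    ; ¬-homo = λ x → D¬x≈¬¬x x , refl
    ; D-homo = λ x → sym (¬Dx≈DDx x) , ¬¬Dx≈Dx x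
    ; 0-homo = Dual.¬⊤≈⊥ , trans (¬-cong ¬⊥≈⊤) ¬⊤≈⊥
    ; c-homo = Dc≈1 , trans (¬-cong ¬c≈0) ¬⊥≈⊤
    ; 1-homo = Dual.¬⊥≈⊤ , trans (¬-cong ¬⊤≈⊥) ¬⊥≈⊤
    }

  -- Split `x` along `y ∨ D y = 1`. The part in `D y` is `x ∧ D x`, which regularity puts below
  -- `y ∨ ¬ y`. Its part in `¬ y` lies in `x ∧ ¬ x = 0`, so all that remains is below `y`.
  D,¬-determine-≤ : ∀ {x y} → D x ≈ D y → ¬ x ≈ ¬ y → x ≤ y
  D,¬-determine-≤ {x} {y} Dx≈Dy ¬x≈¬y = begin
    x                 ≈⟨ ∧-identityʳ x ⟨
    x ∧ 1#            ≈⟨ ∧-congˡ (x∨Dx≈1 y) ⟨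
    x ∧ (y ∨ D y)     ≈⟨ ∧-distribˡ-∨ x y (D y) ⟩
    x ∧ y ∨ x ∧ D y   ≈⟨ ∨-congˡ (∧-congˡ Dx≈Dy) ⟨
    x ∧ y ∨ x ∧ D x   ≤⟨ ∨-least (x∧y≤y x y) (begin
      x ∧ D x             ≤⟨ ∧-greatest (x∧y≤x x (D x)) (regular x y) ⟩
      x ∧ (y ∨ ¬ y)       ≈⟨ ∧-distribˡ-∨ x y (¬ y) ⟩
      x ∧ y ∨ x ∧ ¬ y     ≈⟨ ∨-congˡ (∧-congˡ ¬x≈¬y) ⟨
      x ∧ y ∨ x ∧ ¬ x     ≈⟨ ∨-congˡ (∧-complementʳ x) ⟩
      x ∧ y ∨ 0#          ≤⟨ ∨-least (x∧y≤y x y) (⊥≤ y) ⟩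
      y                   ∎) ⟩
    y                 ∎

  toContract-injective : Injective _≈_ (Algebra._≈_ (contractAlgebra skeleton)) toContract
  toContract-injective {x} {y} (Dx≈Dy , ¬¬x≈¬¬y) =
    antisym (D,¬-determine-≤ Dx≈Dy ¬x≈¬y) (D,¬-determine-≤ (sym Dx≈Dy) (sym ¬x≈¬y))
    where
    ¬x≈¬y : ¬ x ≈ ¬ y
    ¬x≈¬y = trans (sym (¬¬¬x≈¬x x)) (trans (¬-cong ¬¬x≈¬¬y) (¬¬¬x≈¬x y))

  -- Computed in `C(B)` with `u` read as `(u ′ , u)`: `b ∧ c` is `(1 , b)` and `¬ a` is `(a , a ′)`.
  -- Their join is `(a , b ∪ a ′)`, which is `(a , b)` because `a ∪ b = 1` gives `a ′ ≤ b`.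
  fromContract : Contract skeleton → Carrier
  fromContract (((a , _) , (b , _)) , _) = b ∧ c ∨ ¬ a

  toContract∘fromContract : ∀ p → Algebra._≈_ (contractAlgebra skeleton)
                                    (toContract (fromContract p)) p
  toContract∘fromContract (((a , ¬¬a≈a) , (b , ¬¬b≈b)) , a∨b≈1) =
    (begin-equality
      D (b ∧ c ∨ ¬ a)           ≈⟨ Dualₚ.¬-∧ _ _ ⟩
      D (b ∧ c) ∧ D (¬ a)       ≈⟨ ∧-cong (Dualₚ.¬-∨ b c) (trans (D¬x≈¬¬x a) ¬¬a≈a) ⟩
      (D b ∨ D c) ∧ a           ≈⟨ ∧-congʳ (∨-congˡ Dc≈1) ⟩
      (D b ∨ 1#) ∧ a            ≈⟨ ∧-congʳ (antisym (≤⊤ _) (y≤x∨y _ _)) ⟩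
      1# ∧ a                    ≈⟨ ∧-comm 1# a ⟩
      a ∧ 1#                    ≈⟨ ∧-identityʳ a ⟩
      a                         ∎) ,
    (begin-equality
      ¬ ¬ (b ∧ c ∨ ¬ a)         ≈⟨ ¬¬-∨ _ _ ⟩
      ¬ ¬ (b ∧ c) ∨ ¬ ¬ ¬ a     ≈⟨ ∨-cong (¬¬-∧ b c) (¬¬¬x≈¬x a) ⟩
      ¬ ¬ b ∧ ¬ ¬ c ∨ ¬ a       ≈⟨ ∨-congʳ (∧-cong ¬¬b≈b (trans (¬-cong ¬c≈0) ¬⊥≈⊤)) ⟩
      b ∧ 1# ∨ ¬ a              ≈⟨ ∨-congʳ (∧-identityʳ b) ⟩
      b ∨ ¬ a                   ≈⟨ antisym (∨-least ≤-refl ¬a≤b) (x≤x∨y b (¬ a)) ⟩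
      b                         ∎)
    where
    -- The contract condition `a ∨ b = 1` enters here, through minimality of `D a`.
    ¬a≤b : ¬ a ≤ b
    ¬a≤b = ≤-trans (¬x≤Dx a) (D-smallest a∨b≈1)

-- Inverses of bijective homomorphisms.

module _ {𝐀 𝐁 : Algebra ℓ}
         {f : Algebra.Carrier 𝐀 → Algebra.Carrier 𝐁}
         {g : Algebra.Carrier 𝐁 → Algebra.Carrier 𝐀}
         (hom : IsHomomorphism 𝐀 𝐁 f)
         (injective : Injective (Algebra._≈_ 𝐀) (Algebra._≈_ 𝐁) f)
         (f∘g : ∀ y → Algebra._≈_ 𝐁 (f (g y)) y)
         where
  private
    module A = Algebra 𝐀
    module B = Algebra 𝐁
    module f = IsHomomorphism hom

    -- `g` is assumed only to be a right inverse function. Injectivity of `f` then yields everything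
    -- else about it, including that it respects equality.
    transpose : ∀ {x y} → y B.≈ f x → g y A.≈ x
    transpose y≈fx = injective (B.trans (f∘g _) y≈fx)

  inverse-isHomomorphism : IsHomomorphism 𝐁 𝐀 g
  inverse-isHomomorphism = record
    { cong   = λ e → transpose (B.trans e (B.sym (f∘g _)))
    ; ∧-homo = λ x y → transpose
        (B.sym (B.trans (f.∧-homo _ _) (B.∧-cong (f∘g x) (f∘g y))))
    ; ∨-homo = λ x y → transpose
        (B.sym (B.trans (f.∨-homo _ _) (B.∨-cong (f∘g x) (f∘g y))))
    ; ¬-homo = λ x → transpose (B.sym (B.trans (f.¬-homo _) (B.¬-cong (f∘g x))))
    ; D-homo = λ x → transpose (B.sym (B.trans (f.D-homo _) (B.D-cong (f∘g x))))
    ; 0-homo = transpose (B.sym f.0-homo)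
    ; c-homo = transpose (B.sym f.c-homo)
    ; 1-homo = transpose (B.sym f.1-homo)
    }

  inverse-surjective : Surjective B._≈_ A._≈_ g
  inverse-surjective x = f x , transpose

-- `C3DP` as a variety, and the identities in contract algebras.

C3DP-isVariety : IsVariety {ℓ} C3DP
C3DP-isVariety =
  IsVariety-resp-≐ (λ {𝐀} → C3DPProperties.isC3DPAlgebra 𝐀)
    (λ {𝐀} → C3DP⇒Models 𝐀) (Models-isVariety Axiom)

module _ (𝐁 : BooleanAlgebra ℓ ℓ) where
  open BooleanAlgebra 𝐁
  open BooleanAlgebraProperties 𝐁
  open SetoidReasoning setoid

  ∧-¬-relative : ∀ x y → x ∧ ¬ (x ∧ y) ≈ x ∧ ¬ y
  ∧-¬-relative x y = begin
    x ∧ ¬ (x ∧ y)         ≈⟨ ∧-congˡ (deMorgan₁ x y) ⟩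
    x ∧ (¬ x ∨ ¬ y)       ≈⟨ ∧-distribˡ-∨ _ _ _ ⟩
    x ∧ ¬ x ∨ x ∧ ¬ y     ≈⟨ ∨-congʳ (∧-complementʳ x) ⟩
    ⊥ ∨ x ∧ ¬ y           ≈⟨ ∨-identityˡ _ ⟩
    x ∧ ¬ y               ∎

  -- Serves the first component of `¬-relative` and the second of `D-relative`, where the contract
  -- condition is needed. The other components are `∧-¬-relative`.
  x∨y≈⊤⇒x∨y∧z≈x∨z : ∀ {x y} z → x ∨ y ≈ ⊤ → x ∨ y ∧ z ≈ x ∨ z
  x∨y≈⊤⇒x∨y∧z≈x∨z {x} {y} z x∨y≈⊤ = begin
    x ∨ y ∧ z         ≈⟨ ∨-distribˡ-∧ x y z ⟩
    (x ∨ y) ∧ (x ∨ z) ≈⟨ ∧-congʳ x∨y≈⊤ ⟩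
    ⊤ ∧ (x ∨ z)       ≈⟨ ∧-identityˡ _ ⟩
    x ∨ z             ∎

  contractAlgebra-models : Models Axiom (contractAlgebra 𝐁)
  contractAlgebra-models Axiom.∧-comm      ρ = ∨-comm _ _ , ∧-comm _ _
  contractAlgebra-models Axiom.∧-assoc     ρ = ∨-assoc _ _ _ , ∧-assoc _ _ _
  contractAlgebra-models Axiom.∨-comm      ρ = ∧-comm _ _ , ∨-comm _ _
  contractAlgebra-models Axiom.∨-assoc     ρ = ∧-assoc _ _ _ , ∨-assoc _ _ _
  contractAlgebra-models Axiom.∨-absorbs-∧ ρ = ∧-absorbs-∨ _ _ , ∨-absorbs-∧ _ _
  contractAlgebra-models Axiom.∧-absorbs-∨ ρ = ∨-absorbs-∧ _ _ , ∧-absorbs-∨ _ _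
  contractAlgebra-models Axiom.∨-distrib-∧ ρ = ∧-distribˡ-∨ _ _ _ , ∨-distribˡ-∧ _ _ _
  contractAlgebra-models Axiom.∧-distrib-∨ ρ = ∨-distribˡ-∧ _ _ _ , ∧-distribˡ-∨ _ _ _
  contractAlgebra-models Axiom.∨-identity  ρ = ∧-identityʳ _ , ∨-identityʳ _
  contractAlgebra-models Axiom.∧-identity  ρ = ∨-identityʳ _ , ∧-identityʳ _
  contractAlgebra-models Axiom.¬-relative  ρ =
    x∨y≈⊤⇒x∨y∧z≈x∨z _ (proj₂ (ρ 0F)) , ∧-¬-relative _ _
  contractAlgebra-models Axiom.¬0≈1        ρ = refl , ¬⊥≈⊤
  contractAlgebra-models Axiom.¬1≈0        ρ = refl , ¬⊤≈⊥
  contractAlgebra-models Axiom.D-relative  ρ =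
    ∧-¬-relative _ _ , x∨y≈⊤⇒x∨y∧z≈x∨z _ (trans (∨-comm _ _) (proj₂ (ρ 0F)))
  contractAlgebra-models Axiom.D1≈0        ρ = ¬⊥≈⊤ , refl
  contractAlgebra-models Axiom.D0≈1        ρ = ¬⊤≈⊥ , refl
  -- `x ∧ D x` has first component 1 and `y ∨ ¬ y` has second component 1, so the centre `(1 , 1)`
  -- lies between them.
  contractAlgebra-models Axiom.regular     ρ =
    trans (∨-complementʳ _) (sym (trans (∨-congʳ (∨-complementʳ _)) (∨-zeroˡ _))) ,
    sym (trans (∧-congˡ (∨-complementʳ _)) (∧-identityʳ _))
  contractAlgebra-models Axiom.¬-stone     ρ = ∧-complementʳ _ , ∨-complementʳ _
  contractAlgebra-models Axiom.D-stone     ρ = ∨-complementʳ _ , ∧-complementʳ _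
  contractAlgebra-models Axiom.¬c≈0        ρ = refl , ¬⊤≈⊥
  contractAlgebra-models Axiom.Dc≈1        ρ = ¬⊤≈⊥ , refl

corollary4p3 : (ℓ r : Level) → IsVarietyGeneratedBy {ℓ} r C3DP ContractAlgebras
corollary4p3 ℓ r = record
  { isVariety = C3DP-isVariety
  ; contains  = λ { (𝐂 𝐁) → C3DPProperties.isC3DPAlgebra _ (contractAlgebra-models 𝐁) }
  ; smallest  = λ W isVar K⊆W {𝐀} isC3DP →
      let open C3DPProperties 𝐀 (C3DP⇒Models 𝐀 isC3DP)
          𝐁 = StoneAlgebraProperties.skeleton stoneAlgebra
      -- The isomorphism is used in its inverse direction, since `H-closed` asks for a map from the
      -- contract algebra onto `𝐀`.
      in IsVariety.H-closed isVar fromContract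
           (inverse-isHomomorphism toContract-isHomomorphism
             toContract-injective toContract∘fromContract)
           (inverse-surjective toContract-isHomomorphism
             toContract-injective toContract∘fromContract)
           (K⊆W (𝐂 𝐁))
  }
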